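{- There are absolute constants $c,C>0$ such that, for every sufficiently large integer $n$, there exists a $1$-degenerate ordered $3$-graph $F$ on at most $2^{Cn}$ vertices such that \[ r_<\bigl(F,K_3^{(3)}(n)\bigr)>2^{c n^2}. \]
   Context: An ordered $k$-graph is a (finite) $k$-uniform hypergraph equipped with a linear order on its vertex set. An ordered $k$-graph $G$ contains an ordered copy of an ordered $k$-graph $H$ if there is an order-preserving injection $\phi\colon V(H)\to V(G)$ such that $\phi(e)\in E(G)$ for every $e\in E(H)$. For ordered $k$-graphs $G$ and $H$, the ordered Ramsey number $r_<(G,H)$ is the smallest integer $N$ such that every red-blue coloring of the edges of the naturally ordered complete $k$-graph on $[N]=\{1,\dots,N\}$ contains a blue ordered copy of $G$ or a red ordered copy of $H$. $K_3^{(3)}(n)$ denotes the ordered complete tripartite $3$-graph on $3n$ vertices whose three vertex classes are consecutive intervals of size $n$, arranged from left to right; its edges are all triples with exactly one vertex in each class. An ordered $3$-graph $H$ on $t$ vertices is $d$-degenerate (standard degeneracy) if its vertices admit an ordering $u_1,\ldots,u_t$ (not necessarily related to the given linear order on $V(H)$) such that, for every $i$, \[ \bigl|\{e\in E(H): u_i\in e \text{ and } e\setminus\{u_i\}\subseteq\{u_1,\ldots,u_{i-1}\}\}\bigr|\le d. \] -}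

module Defs where

open import Level using (0ℓ)
open import Data.Nat using (ℕ; _+_; _*_; _^_; _≤_; _<_; _≤?_; _<?_)
open import Data.Integer using (∣_∣)
open import Data.Rational using (ℚ; ↥_; ↧ₙ_)
open import Data.Fin as Fin using (Fin; toℕ)
import Data.Fin.Properties as Fin
open import Data.Fin.Permutation using (Permutation′; _⟨$⟩ʳ_)
open import Data.Vec using (Vec; []; _∷_; map)
open import Data.Vec.Membership.Propositional using (_∈_)
open import Data.Vec.Relation.Unary.Linked using (Linked; []; [-]; _∷_; linked?)
open import Data.List as List using (List)
open import Data.List.Relation.Unary.All using (All)
open import Data.List.Relation.Unary.Unique.Propositional using (Unique)
open import Data.Product using (Σ; ∃; _×_; _,_; proj₁)
open import Data.Sum using (_⊎_)
open import Relation.Binary.Core using (_Preserves_⟶_)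
open import Relation.Binary.Definitions using (DecidableEquality)
open import Relation.Binary.PropositionalEquality using (_≡_; _≢_; refl)
open import Relation.Nullary.Decidable using (yes; no; _×-dec_)
open import Relation.Unary using (Pred; Decidable)

Increasing : ∀ {n k} → Vec (Fin n) k → Set
Increasing = Linked Fin._<_

-- A finite linearly ordered vertex set is taken to be Fin size with its
-- usual order.  A k-element set of vertices is represented by the unique
-- strictly increasing vector listing its elements.
record OrderedGraph (k : ℕ) : Set₁ where
  field
    size       : ℕ
    Edge       : Pred (Vec (Fin size) k) 0ℓ
    edge?      : Decidable Edge
    increasing : ∀ {e} → Edge e → Increasing e

open OrderedGraph public

-- An order-preserving injection between linear orders is the same as a
-- strictly monotone map; such a map sends increasing vectors to
-- increasing vectors, so map φ e lists the image of the vertex set e.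
Contains : ∀ {k} → OrderedGraph k → OrderedGraph k → Set
Contains G H =
  Σ (Fin (size H) → Fin (size G)) λ φ →
    (φ Preserves Fin._<_ ⟶ Fin._<_) × (∀ {e} → Edge H e → Edge G (map φ e))

data Colour : Set where
  red blue : Colour

_≟ᶜ_ : DecidableEquality Colour
red  ≟ᶜ red  = yes refl
red  ≟ᶜ blue = no λ ()
blue ≟ᶜ red  = no λ ()
blue ≟ᶜ blue = yes refl

-- The values of a colouring on vectors that are not increasing (and so
-- are not edges of the complete k-graph) are never used.
Colouring : ℕ → ℕ → Set
Colouring k N = Vec (Fin N) k → Colour

colourClass : ∀ {k N} → Colouring k N → Colour → OrderedGraph k
colourClass {k} {N} χ c = record
  { size       = N
  ; Edge       = λ e → Increasing e × χ e ≡ c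
  ; edge?      = λ e → linked? Fin._<?_ e ×-dec (χ e ≟ᶜ c)
  ; increasing = proj₁
  }

Arrows : ∀ {k} → ℕ → OrderedGraph k → OrderedGraph k → Set
Arrows {k} N G H =
  ∀ (χ : Colouring k N) →
    Contains (colourClass χ blue) G ⊎ Contains (colourClass χ red) H

IsOrderedRamseyNumber : ∀ {k} → OrderedGraph k → OrderedGraph k → ℕ → Set
IsOrderedRamseyNumber G H r = Arrows r G H × (∀ N → Arrows N G H → r ≤ N)

-- The cardinality of P is at most d.
AtMost : ∀ {A : Set} → ℕ → Pred A 0ℓ → Set
AtMost {A} d P = ∀ (xs : List A) → Unique xs → All P xs → List.length xs ≤ d

BackEdge : ∀ {k} (H : OrderedGraph k) → Permutation′ (size H) →
           Fin (size H) → Pred (Vec (Fin (size H)) k) 0ℓ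
BackEdge H u i e =
  Edge H e × (u ⟨$⟩ʳ i) ∈ e ×
  (∀ {v} → v ∈ e → v ≢ u ⟨$⟩ʳ i → ∃ λ j → (j Fin.< i) × (v ≡ u ⟨$⟩ʳ j))

Degenerate : ∀ {k} → ℕ → OrderedGraph k → Set
Degenerate d H =
  Σ (Permutation′ (size H)) λ u → ∀ i → AtMost d (BackEdge H u i)

-- With vertices numbered from 0, class j is the interval [j n, (j + 1) n).
InClass : ∀ {n} → ℕ → Fin (3 * n) → Set
InClass {n} j v = (j * n ≤ toℕ v) × (toℕ v < (j + 1) * n)

K₃ : ℕ → OrderedGraph 3
K₃ n = record
  { size       = 3 * n
  ; Edge       = TransversalTriple
  ; edge?      = dec
  ; increasing = inc
  }
  where
  open import Data.Nat.Properties using (<-≤-trans)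

  -- The classes are ordered left to right, so an increasing triple with
  -- one vertex in each class has its vertices in classes 0, 1, 2 in turn.
  TransversalTriple : Pred (Vec (Fin (3 * n)) 3) 0ℓ
  TransversalTriple (a ∷ b ∷ c ∷ []) = InClass {n} 0 a × InClass {n} 1 b × InClass {n} 2 c

  inClass? : ∀ j → Decidable (InClass {n} j)
  inClass? j v = (j * n ≤? toℕ v) ×-dec (toℕ v <? (j + 1) * n)

  dec : Decidable TransversalTriple
  dec (a ∷ b ∷ c ∷ []) = inClass? 0 a ×-dec inClass? 1 b ×-dec inClass? 2 c

  inc : ∀ {e} → TransversalTriple e → Increasing e
  inc {a ∷ b ∷ c ∷ []} ((_ , a<) , (≤b , b<) , (≤c , _)) =
    <-≤-trans a< ≤b ∷ <-≤-trans b< ≤c ∷ [-]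

-- For q = a / b > 0 in lowest terms, 2^(q m) < x  iff  2^(a m) < x^b, and
-- likewise for x ≤ 2^(q m).  Only meant for q ≥ 0: the sign of q is ignored.
-- Positive real constants in such bounds can be replaced by rational ones by
-- decreasing a constant in a lower bound, increasing one in an upper bound.
2^[_·_]<_ : ℚ → ℕ → ℕ → Set
2^[ q · m ]< x = 2 ^ (∣ ↥ q ∣ * m) < x ^ (↧ₙ q)

_≤2^[_·_] : ℕ → ℚ → ℕ → Set
x ≤2^[ q · m ] = x ^ (↧ₙ q) ≤ 2 ^ (∣ ↥ q ∣ * m)

{-# OPTIONS --safe #-}

-- Take two classes A < B of m vertices each and hang on every pair
-- (a , b) ∈ A × B its own apex to the right of B.  If a triple x < y < z
-- gets the colour of the pair (x , y) in a two-coloured Fin N × Fin N, a blue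
-- copy of this 1-degenerate 3-graph contains a blue m × m rectangle, and a
-- red K₃ n contains a red n × n rectangle.  Colouring pairs red independently
-- with probability 8⁻ⁿ, a union bound excludes both kinds of rectangle for
-- N = 2^(n²) and m = 8ⁿ · 8ⁿ.
module Submission where

open import Defs
open import Level using (0ℓ)
open import Data.Nat hiding (_/_)
open import Data.Nat.Properties
open import Data.Nat.Solver using (module +-*-Solver)
open import Data.Nat.ListAction using (sum)
import Data.Integer as ℤ
open import Data.Rational using (ℚ; 1ℚ; Positive; _/_)
open import Data.Fin as Fin
  using (Fin; zero; suc; toℕ; fromℕ<; inject≤; splitAt; join; combine; remQuot;
         finToFun; funToFin; punchOut; _↑ˡ_; _↑ʳ_)
import Data.Fin.Properties as Fin
import Data.Fin.Permutation as Perm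
open import Data.Fin.Subset using (Subset; inside; outside; ⊥; ∣_∣)
import Data.Fin.Subset.Properties as Subset
open import Data.Vec as Vec using (Vec; []; _∷_; lookup; _[_]≔_)
import Data.Vec.Properties as Vec
open import Data.Vec.Relation.Unary.Any using (here; there)
open import Data.Vec.Relation.Unary.Linked as Linked using ([-]; _∷_)
import Data.Vec.Relation.Unary.Linked.Properties as Linked
open import Data.List as List using (List; []; _∷_; length; filter)
import Data.List.Properties as List
open import Data.List.Membership.Propositional using (_∈_)
open import Data.List.Membership.Propositional.Properties using (∈-map⁺; ∈-filter⁺; ∈-allFin)
open import Data.List.Relation.Unary.Any using (here; there)
open import Data.List.Relation.Unary.All using (All; []; _∷_)
open import Data.List.Relation.Unary.All.Properties using (all-filter)
open import Data.List.Relation.Unary.AllPairs using (_∷_)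
open import Data.Product
open import Data.Sum as Sum using (_⊎_; inj₁; inj₂)
open import Function using (_∘_; id; Injective)
open import Relation.Binary.Core using (_Preserves_⟶_)
open import Relation.Binary.Definitions using (tri<; tri≈; tri>)
open import Relation.Binary.PropositionalEquality
open import Relation.Nullary
open import Relation.Nullary.Decidable using (_×-dec_; _⊎-dec_; _→-dec_; map′)
open import Relation.Unary using (Pred; Decidable)

-- Random two-colourings of pairs

-- The two kinds of rectangle pull in opposite directions, and the exponential size allowed for F
-- lets blue be almost certain. Write q = 8ⁿ. A red n × n rectangle has probability q^(-n²) =
-- 2^(-3n³), against N^(2n) = 2^(2n³) choices of rows and columns. A blue m × m rectangle has
-- probability (1 - 1/q)^(m²) ≤ 2^(-m²/q), against 2^(2n²m) choices, so m/q has to exceed roughly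
-- 2n²; m = q² makes it q. Everything stays in ℕ: q is `suc p`, and each probability is multiplied
-- through by a power of q. A good colouring refutes `Arrows N` only. The number r must also be
-- exhibited, which constructively takes some finite upper bound, a decision procedure for `Arrows`,
-- and a search for the least value.

mono : ∀ {E} → Colour → Subset E → Vec Colour E → ℕ
mono c    []            []         = 1
mono c    (outside ∷ S) (_ ∷ v)    = mono c S v
mono red  (inside ∷ S)  (red ∷ v)  = mono red S v
mono red  (inside ∷ S)  (blue ∷ v) = 0
mono blue (inside ∷ S)  (red ∷ v)  = 0
mono blue (inside ∷ S)  (blue ∷ v) = mono blue S v

mono≡1 : ∀ {E} c (S : Subset E) v →
         (∀ e → lookup S e ≡ inside → lookup v e ≡ c) → mono c S v ≡ 1
mono≡1 c    []            []         h = refl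
mono≡1 c    (outside ∷ S) (_ ∷ v)    h = mono≡1 c S v (h ∘ suc)
mono≡1 red  (inside ∷ S)  (red ∷ v)  h = mono≡1 red S v (h ∘ suc)
mono≡1 red  (inside ∷ S)  (blue ∷ v) h with () ← h zero refl
mono≡1 blue (inside ∷ S)  (red ∷ v)  h with () ← h zero refl
mono≡1 blue (inside ∷ S)  (blue ∷ v) h = mono≡1 blue S v (h ∘ suc)

-- As `mono` is a 0/1 indicator, this is the number of listed sets that `v` colours entirely `c`.
monoCount : ∀ {E} → Colour → List (Subset E) → Vec Colour E → ℕ
monoCount c Ss v = sum (List.map (λ S → mono c S v) Ss)

mono≤monoCount : ∀ {E} c {S : Subset E} {Ss} v → S ∈ Ss → mono c S v ≤ monoCount c Ss v
mono≤monoCount c v (here refl) = m≤m+n _ _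
mono≤monoCount c v (there S∈)  = ≤-trans (mono≤monoCount c v S∈) (m≤n+m _ _)

module Weighted (p : ℕ) where

  weight : Colour → ℕ
  weight red  = 1
  weight blue = p

  -- (suc p) ^ E times the expectation of g when the E entries are
  -- independent, each red with probability 1 / suc p.
  𝔼 : ∀ {E} → (Vec Colour E → ℕ) → ℕ
  𝔼 {zero}  g = g []
  𝔼 {suc E} g = 𝔼 (g ∘ (red ∷_)) + p * 𝔼 (g ∘ (blue ∷_))

  𝔼-zero : ∀ E → 𝔼 {E} (λ _ → 0) ≡ 0
  𝔼-zero zero = refl
  𝔼-zero (suc E) rewrite 𝔼-zero E = *-zeroʳ p

  𝔼-+ : ∀ {E} (g h : Vec Colour E → ℕ) → 𝔼 (λ v → g v + h v) ≡ 𝔼 g + 𝔼 h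
  𝔼-+ {zero}  g h = refl
  𝔼-+ {suc E} g h
    rewrite 𝔼-+ (g ∘ (red ∷_)) (h ∘ (red ∷_)) | 𝔼-+ (g ∘ (blue ∷_)) (h ∘ (blue ∷_)) =
    solve 5 (λ a b c d p → a :+ b :+ p :* (c :+ d) := a :+ p :* c :+ (b :+ p :* d)) refl
      (𝔼 (g ∘ (red ∷_))) _ (𝔼 (g ∘ (blue ∷_))) _ p
    where open +-*-Solver

  -- First moment method: a ℕ-valued variable of mean below 1 vanishes somewhere. The outcome is
  -- found entry by entry, since conditioning on red or on blue must keep the mean below 1.
  𝔼-small⇒zero : ∀ {E} (g : Vec Colour E → ℕ) → 𝔼 g < suc p ^ E → ∃ λ v → g v ≡ 0
  𝔼-small⇒zero {zero}  g lt = [] , n<1⇒n≡0 lt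
  𝔼-small⇒zero {suc E} g lt
    with 𝔼 (g ∘ (red ∷_)) <? suc p ^ E | 𝔼 (g ∘ (blue ∷_)) <? suc p ^ E
  ... | yes r | _     = map (red ∷_) id (𝔼-small⇒zero _ r)
  ... | no _  | yes b = map (blue ∷_) id (𝔼-small⇒zero _ b)
  ... | no r  | no b  =
    contradiction lt (≤⇒≯ (+-mono-≤ (≮⇒≥ r) (*-monoʳ-≤ p (≮⇒≥ b))))

  -- The probability (`weight c` / q)^∣S∣ with denominators cleared: an entry outside `S`
  -- contributes the factor 1 + p = q, an entry inside only `weight c`.
  𝔼-mono : ∀ {E} c (S : Subset E) →
           𝔼 (mono c S) * suc p ^ ∣ S ∣ ≡ weight c ^ ∣ S ∣ * suc p ^ E
  𝔼-mono c [] = refl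
  𝔼-mono {suc E} c (outside ∷ S) = begin
    (a + p * a) * x      ≡⟨ *-assoc (suc p) a x ⟩
    suc p * (a * x)      ≡⟨ cong (suc p *_) (𝔼-mono c S) ⟩
    suc p * (y * z)      ≡⟨ solve 3 (λ s y z → s :* (y :* z) := y :* (s :* z)) refl (suc p) y z ⟩
    y * (suc p * z)      ∎
    where
    open ≡-Reasoning
    open +-*-Solver
    a = 𝔼 (mono c S)
    x = suc p ^ ∣ S ∣
    y = weight c ^ ∣ S ∣
    z = suc p ^ E
  𝔼-mono {suc E} red (inside ∷ S) rewrite 𝔼-zero E = begin
    (a + p * 0) * (suc p * x) ≡⟨ solve 4 (λ a p s x → (a :+ p :* con 0) :* (s :* x) := s :* (a :* x)) refl a p (suc p) x ⟩
    suc p * (a * x)           ≡⟨ cong (suc p *_) (𝔼-mono red S) ⟩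
    suc p * (y * z)           ≡⟨ solve 3 (λ s y z → s :* (y :* z) := con 1 :* y :* (s :* z)) refl (suc p) y z ⟩
    1 * y * (suc p * z)       ∎
    where
    open ≡-Reasoning
    open +-*-Solver
    a = 𝔼 (mono red S)
    x = suc p ^ ∣ S ∣
    y = 1 ^ ∣ S ∣
    z = suc p ^ E
  𝔼-mono {suc E} blue (inside ∷ S) rewrite 𝔼-zero E = begin
    p * a * (suc p * x)   ≡⟨ solve 4 (λ a p s x → p :* a :* (s :* x) := s :* p :* (a :* x)) refl a p (suc p) x ⟩
    suc p * p * (a * x)   ≡⟨ cong (suc p * p *_) (𝔼-mono blue S) ⟩
    suc p * p * (y * z)   ≡⟨ solve 4 (λ s p y z → s :* p :* (y :* z) := p :* y :* (s :* z)) refl (suc p) p y z ⟩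
    p * y * (suc p * z)   ∎
    where
    open ≡-Reasoning
    open +-*-Solver
    a = 𝔼 (mono blue S)
    x = suc p ^ ∣ S ∣
    y = p ^ ∣ S ∣
    z = suc p ^ E

  𝔼-monoCount : ∀ {E} c k {Ss : List (Subset E)} → All (λ S → ∣ S ∣ ≡ k) Ss →
                𝔼 (monoCount c Ss) * suc p ^ k ≡ length Ss * weight c ^ k * suc p ^ E
  𝔼-monoCount {E} c k [] = cong (_* suc p ^ k) (𝔼-zero E)
  𝔼-monoCount {E} c k {S ∷ Ss} (refl ∷ all) = begin
    𝔼 (monoCount c (S ∷ Ss)) * x               ≡⟨ cong (_* x) (𝔼-+ (mono c S) (monoCount c Ss)) ⟩
    (𝔼 (mono c S) + 𝔼 (monoCount c Ss)) * x    ≡⟨ *-distribʳ-+ x (𝔼 (mono c S)) _ ⟩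
    𝔼 (mono c S) * x + 𝔼 (monoCount c Ss) * x  ≡⟨ cong₂ _+_ (𝔼-mono c S) (𝔼-monoCount c k all) ⟩
    y * z + length Ss * y * z                  ≡⟨ *-distribʳ-+ z y (length Ss * y) ⟨
    (y + length Ss * y) * z                    ∎
    where
    open ≡-Reasoning
    x = suc p ^ k
    y = weight c ^ k
    z = suc p ^ E

  -- Union bound: the expected number of red sets is below 1/2 and that of blue sets at most 1/2, so
  -- the total has mean below 1 and both counts vanish together.
  avoiding-colouring : ∀ {E k l} {Rs Bs : List (Subset E)} →
    All (λ S → ∣ S ∣ ≡ k) Rs → All (λ S → ∣ S ∣ ≡ l) Bs →
    2 * length Rs < suc p ^ k → 2 * length Bs * p ^ l ≤ suc p ^ l →
    ∃ λ v → (monoCount red Rs v ≡ 0) × (monoCount blue Bs v ≡ 0)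
  avoiding-colouring {E} {k} {l} {Rs} {Bs} allR allB few-R few-B =
    let v , eq = 𝔼-small⇒zero (λ v → monoCount red Rs v + monoCount blue Bs v)
                   (subst (_< z) (sym (𝔼-+ (monoCount red Rs) (monoCount blue Bs))) A+B<z)
    in v , m+n≡0⇒m≡0 _ eq , m+n≡0⇒n≡0 _ eq
    where
    A = 𝔼 (monoCount red Rs)
    B = 𝔼 (monoCount blue Bs)
    z = suc p ^ E

    open +-*-Solver
    instance
      _ : NonZero z
      _ = m^n≢0 (suc p) E
      _ : NonZero (suc p ^ l)
      _ = m^n≢0 (suc p) l

    2A<z : 2 * A < z
    2A<z = *-cancelʳ-< (suc p ^ k) (2 * A) z (begin-strict
      2 * A * suc p ^ k               ≡⟨ *-assoc 2 A _ ⟩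
      2 * (A * suc p ^ k)             ≡⟨ cong (2 *_) (𝔼-monoCount red k allR) ⟩
      2 * (length Rs * 1 ^ k * z)     ≡⟨ cong (λ t → 2 * (length Rs * t * z)) (^-zeroˡ k) ⟩
      2 * (length Rs * 1 * z)         ≡⟨ solve 2 (λ r z → con 2 :* (r :* con 1 :* z) := con 2 :* r :* z) refl (length Rs) z ⟩
      2 * length Rs * z               <⟨ *-monoˡ-< z few-R ⟩
      suc p ^ k * z                   ≡⟨ *-comm _ z ⟩
      z * suc p ^ k                   ∎)
      where open ≤-Reasoning

    2B≤z : 2 * B ≤ z
    2B≤z = *-cancelʳ-≤ (2 * B) z (suc p ^ l) (begin
      2 * B * suc p ^ l               ≡⟨ *-assoc 2 B _ ⟩
      2 * (B * suc p ^ l)             ≡⟨ cong (2 *_) (𝔼-monoCount blue l allB) ⟩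
      2 * (length Bs * p ^ l * z)     ≡⟨ solve 3 (λ r t z → con 2 :* (r :* t :* z) := con 2 :* r :* t :* z) refl (length Bs) (p ^ l) z ⟩
      2 * length Bs * p ^ l * z       ≤⟨ *-monoˡ-≤ z few-B ⟩
      suc p ^ l * z                   ≡⟨ *-comm _ z ⟩
      z * suc p ^ l                   ∎)
      where open ≤-Reasoning

    A+B<z : A + B < z
    A+B<z = *-cancelˡ-< 2 (A + B) z (begin-strict
      2 * (A + B)    ≡⟨ *-distribˡ-+ 2 A B ⟩
      2 * A + 2 * B  <⟨ +-mono-<-≤ 2A<z 2B≤z ⟩
      z + z          ≡⟨ cong (z +_) (+-identityʳ z) ⟨
      2 * z          ∎)
      where open ≤-Reasoning

-- Rectangles as sets of cells of the N × N grid

image : ∀ {k E} → (Fin k → Fin E) → Subset E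
image {zero}  f = ⊥
image {suc k} f = image (f ∘ suc) [ f zero ]≔ inside

image⁻ : ∀ {k E} (f : Fin k → Fin E) e → lookup (image f) e ≡ inside → ∃ λ i → f i ≡ e
image⁻ {zero}  f e e∈ with () ← trans (sym (Vec.lookup-replicate e outside)) e∈
image⁻ {suc k} f e e∈ with f zero Fin.≟ e
... | yes eq = zero , eq
... | no neq = map suc id (image⁻ (f ∘ suc) e
  (trans (sym (Vec.lookup∘update′ (neq ∘ sym) (image (f ∘ suc)) inside)) e∈))

∣insert∣ : ∀ {E} (S : Subset E) e → lookup S e ≡ outside → ∣ S [ e ]≔ inside ∣ ≡ suc ∣ S ∣
∣insert∣ (outside ∷ S) zero    _  = refl
∣insert∣ (outside ∷ S) (suc e) e∉ = ∣insert∣ S e e∉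
∣insert∣ (inside ∷ S)  (suc e) e∉ = cong suc (∣insert∣ S e e∉)

∣image∣ : ∀ {k E} (f : Fin k → Fin E) → Injective _≡_ _≡_ f → ∣ image f ∣ ≡ k
∣image∣ {zero} {E} f inj = Subset.∣⊥∣≡0 E
∣image∣ {suc k} f inj with lookup (image (f ∘ suc)) (f zero) in eq
... | inside with i , fi≡ ← image⁻ (f ∘ suc) (f zero) eq with () ← inj fi≡
... | outside = trans (∣insert∣ (image (f ∘ suc)) (f zero) eq)
                      (cong suc (∣image∣ (f ∘ suc) (Fin.suc-injective ∘ inj)))

rectangle : ∀ {k N} → (Fin k → Fin N) → (Fin k → Fin N) → Fin (k * k) → Fin (N * N)
rectangle {k} X Y t = let i , j = remQuot {k} k t in combine (X i) (Y j)

rectangle-injective : ∀ {k N} {X Y : Fin k → Fin N} →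
  Injective _≡_ _≡_ X → Injective _≡_ _≡_ Y → Injective _≡_ _≡_ (rectangle X Y)
rectangle-injective {k} {X = X} {Y} injX injY {s} {t} eq =
  let Xeq , Yeq = Fin.combine-injective (X _) (Y _) (X _) (Y _) eq in
  trans (sym (Fin.combine-remQuot {k} k s))
    (trans (cong₂ combine (injX Xeq) (injY Yeq)) (Fin.combine-remQuot {k} k t))

-- A pair of maps Fin k → Fin N is coded by one index below N ^ k * N ^ k.
codedRectangle : ∀ k N → Fin (N ^ k * N ^ k) → Subset (N * N)
codedRectangle k N t =
  let x , y = remQuot {N ^ k} (N ^ k) t in image (rectangle {k} (finToFun x) (finToFun y))

codedRectangles : ∀ k N → List (Subset (N * N))
codedRectangles k N = List.map (codedRectangle k N) (List.allFin (N ^ k * N ^ k))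

-- The union bound wants sets of one common size. Filtering by size discards degenerate codes, while
-- every pair of injective maps survives by `∣image∣`.
rectangles : ∀ k N → List (Subset (N * N))
rectangles k N = filter (λ S → ∣ S ∣ ≟ k * k) (codedRectangles k N)

rectangles-size : ∀ k N → All (λ S → ∣ S ∣ ≡ k * k) (rectangles k N)
rectangles-size k N = all-filter (λ S → ∣ S ∣ ≟ k * k) (codedRectangles k N)

length-rectangles : ∀ k N → length (rectangles k N) ≤ N ^ k * N ^ k
length-rectangles k N = begin
  length (rectangles k N)                              ≤⟨ List.length-filter (λ S → ∣ S ∣ ≟ k * k) (codedRectangles k N) ⟩
  length (codedRectangles k N)                         ≡⟨ List.length-map (codedRectangle k N) (List.allFin _) ⟩
  length (List.allFin (N ^ k * N ^ k))                 ≡⟨ List.length-tabulate id ⟩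
  N ^ k * N ^ k                                        ∎
  where open ≤-Reasoning

NoMonochromatic : ∀ {N} → (Fin N → Fin N → Colour) → Colour → ℕ → Set
NoMonochromatic {N} χ c k =
  ∀ (X Y : Fin k → Fin N) → Injective _≡_ _≡_ X → Injective _≡_ _≡_ Y →
  ¬ (∀ i j → χ (X i) (Y j) ≡ c)

monoCount≡0⇒NoMonochromatic : ∀ {N} c k (v : Vec Colour (N * N)) →
  monoCount c (rectangles k N) v ≡ 0 → NoMonochromatic (λ x y → lookup v (combine x y)) c k
monoCount≡0⇒NoMonochromatic {N} c k v none X Y injX injY all-c = contradiction 1≤0 λ ()
  where
  -- `X` and `Y` are replaced by their decoded codes, which agree with them only pointwise, because
  -- it is the decoded maps whose image occurs in the list.
  x = funToFin X
  y = funToFin Y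
  X′ = finToFun x
  Y′ = finToFun y
  X′≗X = Fin.finToFun-funToFin X
  Y′≗Y = Fin.finToFun-funToFin Y

  S = image (rectangle {k} X′ Y′)

  ∣S∣ : ∣ S ∣ ≡ k * k
  ∣S∣ = ∣image∣ (rectangle X′ Y′) (rectangle-injective
    (λ {i} {j} eq → injX (trans (sym (X′≗X i)) (trans eq (X′≗X j))))
    (λ {i} {j} eq → injY (trans (sym (Y′≗Y i)) (trans eq (Y′≗Y j)))))

  S∈ : S ∈ rectangles k N
  S∈ = ∈-filter⁺ (λ S → ∣ S ∣ ≟ k * k)
    (subst (_∈ _)
      (cong (λ (x , y) → image (rectangle {k} (finToFun x) (finToFun y))) (Fin.remQuot-combine x y))
      (∈-map⁺ (codedRectangle k N) (∈-allFin (combine x y))))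
    ∣S∣

  S-mono : ∀ e → lookup S e ≡ inside → lookup v e ≡ c
  S-mono e e∈ with t , refl ← image⁻ (rectangle {k} X′ Y′) e e∈ =
    trans (cong (lookup v) (cong₂ combine (X′≗X _) (Y′≗Y _))) (all-c _ _)

  1≤0 : 1 ≤ 0
  1≤0 = subst₂ _≤_ (mono≡1 c S v S-mono) none (mono≤monoCount c v S∈)

random-colouring : ∀ p n m N →
  2 * (N ^ n * N ^ n) < suc p ^ (n * n) →
  2 * (N ^ m * N ^ m) * p ^ (m * m) ≤ suc p ^ (m * m) →
  ∃ λ (χ : Fin N → Fin N → Colour) → NoMonochromatic χ red n × NoMonochromatic χ blue m
random-colouring p n m N few-red few-blue =
  let v , no-red , no-blue = avoiding-colouring (rectangles-size n N) (rectangles-size m N)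
        (≤-<-trans (*-monoʳ-≤ 2 (length-rectangles n N)) few-red)
        (≤-trans (*-monoˡ-≤ (p ^ (m * m)) (*-monoʳ-≤ 2 (length-rectangles m N))) few-blue)
  in (λ x y → lookup v (combine x y)) ,
     monoCount≡0⇒NoMonochromatic red n v no-red ,
     monoCount≡0⇒NoMonochromatic blue m v no-blue
  where open Weighted p

-- The Ramsey upper bound

Monotone : ∀ {a b} → (Fin a → Fin b) → Set
Monotone f = f Preserves Fin._<_ ⟶ Fin._<_

monotone⇒injective : ∀ {a b} {f : Fin a → Fin b} → Monotone f → Injective _≡_ _≡_ f
monotone⇒injective mono {i} {j} eq with Fin.<-cmp i j
... | tri< i<j _ _ = contradiction eq (Fin.<⇒≢ (mono i<j))
... | tri≈ _ i≡j _ = i≡j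
... | tri> _ _ j<i = contradiction (sym eq) (Fin.<⇒≢ (mono j<i))

inject≤-monotone : ∀ {a b} (a≤b : a ≤ b) → Monotone (λ i → inject≤ i a≤b)
inject≤-monotone a≤b {i} {j} =
  subst₂ _<_ (sym (Fin.toℕ-inject≤ i a≤b)) (sym (Fin.toℕ-inject≤ j a≤b))

record Selection {M} (P : Pred (Fin M) _) (a : ℕ) : Set where
  constructor selection
  field
    pick     : Fin a → Fin M
    monotone : Monotone pick
    satisfy  : ∀ i → P (pick i)

nothing-selected : ∀ {M} {P : Pred (Fin M) _} → Selection P 0
nothing-selected = selection (λ ()) (λ { {()} }) (λ ())

select-later : ∀ {M a} {P : Pred (Fin (suc M)) _} → Selection (P ∘ suc) a → Selection P a
select-later (selection g mono sat) = selection (suc ∘ g) (s<s ∘ mono) sat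

select-first : ∀ {M a} {P : Pred (Fin (suc M)) _} →
               P zero → Selection (P ∘ suc) a → Selection P (suc a)
select-first {M} {a} {P} p₀ (selection g mono sat) = selection g′ mono′ sat′
  where
  g′ : Fin (suc a) → Fin (suc M)
  g′ zero    = zero
  g′ (suc i) = suc (g i)

  mono′ : Monotone g′
  mono′ {zero}  {suc j} _   = z<s
  mono′ {suc i} {suc j} i<j = s<s (mono (s<s⁻¹ i<j))

  sat′ : ∀ i → P (g′ i)
  sat′ zero    = p₀
  sat′ (suc i) = sat i

select : ∀ a b {M} {P : Pred (Fin M) _} → a + b ≤ M → Decidable P →
         Selection P a ⊎ Selection (¬_ ∘ P) b
select zero    b       _  _  = inj₁ nothing-selected
select (suc a) zero    _  _  = inj₂ nothing-selected
select (suc a) (suc b) {suc M} (s≤s le) P? with P? zero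
... | yes p = Sum.map (select-first p) select-later (select a (suc b) le (P? ∘ suc))
... | no ¬p = Sum.map select-later (select-first ¬p)
  (select (suc a) b (subst (_≤ M) (+-suc a b) le) (P? ∘ suc))

-- Either the value `zero` is taken T times, or `suc K * T` points avoid it; on those, `punchOut`
-- lowers the number of values by one.
pigeonhole-suc : ∀ K T {M} → suc K * T ≤ M → (f : Fin M → Fin (suc K)) →
                 ∃ λ k → Selection (λ i → f i ≡ k) T
pigeonhole-suc zero T le f =
  zero , selection (λ i → inject≤ i T≤M) (inject≤-monotone T≤M)
                   (λ i → only (f (inject≤ i T≤M)))
  where
  T≤M = m+n≤o⇒m≤o T le

  only : (i : Fin 1) → i ≡ zero
  only zero = refl
pigeonhole-suc (suc K) T le f with select T (suc K * T) le (λ i → f i Fin.≟ zero)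
... | inj₁ sel = zero , sel
... | inj₂ (selection g g-mono f≢0)
  with k , selection h h-mono eq ← pigeonhole-suc K T ≤-refl (λ i → punchOut (f≢0 i ∘ sym)) =
  suc k , selection (g ∘ h) (g-mono ∘ h-mono)
    (λ i → trans (sym (Fin.punchIn-punchOut (f≢0 (h i) ∘ sym))) (cong suc (eq i)))

pigeonhole : ∀ K T {M} .{{_ : NonZero K}} → K * T ≤ M → (f : Fin M → Fin K) →
             ∃ λ k → Selection (λ i → f i ≡ k) T
pigeonhole (suc K) T = pigeonhole-suc K T

encode : Colour → Fin 2
encode red  = zero
encode blue = suc zero

decode : Fin 2 → Colour
decode zero       = red
decode (suc zero) = blue

decode-encode : ∀ c → decode (encode c) ≡ c
decode-encode red  = refl
decode-encode blue = refl

-- Each row `χ t` is a two-letter word of length P, hence one of 2 ^ P pigeonholes.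
pigeonhole-patterns : ∀ P T (χ : Fin (2 ^ P * T) → Fin P → Colour) →
  ∃ λ (ψ : Fin P → Colour) → Selection (λ t → ∀ i → χ t i ≡ ψ i) T
pigeonhole-patterns P T χ =
  let k , selection g mono eq = pigeonhole (2 ^ P) T {{m^n≢0 2 P}} ≤-refl (λ t → funToFin (encode ∘ χ t))
  in decode ∘ finToFun k , selection g mono λ t i →
       trans (sym (decode-encode (χ (g t) i)))
         (cong decode (trans (sym (Fin.finToFun-funToFin (encode ∘ χ (g t)) i))
                             (cong (λ k → finToFun k i) (eq t))))

module _ (T : ℕ) where

  -- Pigeonholing the last class on its colour patterns costs a factor
  -- 2 ^ (P₁ * P₂), then the middle class one of 2 ^ P₁.
  P₁ P₂ P₃ : ℕ
  P₁ = 2 ^ 1 * T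
  P₂ = 2 ^ P₁ * T
  P₃ = 2 ^ (P₁ * P₂) * T

  record Homogeneous (χ : Fin P₁ → Fin P₂ → Fin P₃ → Colour) : Set where
    field
      f₁ : Fin T → Fin P₁
      f₂ : Fin T → Fin P₂
      f₃ : Fin T → Fin P₃
      mono₁ : Monotone f₁
      mono₂ : Monotone f₂
      mono₃ : Monotone f₃
      colour : Colour
      constant : ∀ i j k → χ (f₁ i) (f₂ j) (f₃ k) ≡ colour

  -- After the last class is thinned the colour depends on the first two coordinates only, after the
  -- middle class on the first only.
  homogeneous : ∀ χ → Homogeneous χ
  homogeneous χ
    with ψ , selection f₃ mono₃ eq₃ ← pigeonhole-patterns (P₁ * P₂) T
           (λ t ij → let i , j = remQuot {P₁} P₂ ij in χ i j t)
    with φ , selection f₂ mono₂ eq₂ ← pigeonhole-patterns P₁ T (λ j i → ψ (combine i j))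
    -- Plain two-colour pigeonhole, phrased as words of length 1; hence the form 2 ^ 1 * T of `P₁`.
    with c , selection f₁ mono₁ eq₁ ← pigeonhole-patterns 1 T (λ i _ → φ i) = record
    { f₁ = f₁ ; f₂ = f₂ ; f₃ = f₃ ; mono₁ = mono₁ ; mono₂ = mono₂ ; mono₃ = mono₃
    ; colour = c zero
    ; constant = λ i j k → begin
        χ (f₁ i) (f₂ j) (f₃ k)
          ≡⟨ cong (λ (x , y) → χ x y (f₃ k)) (Fin.remQuot-combine (f₁ i) (f₂ j)) ⟨
        _                        ≡⟨ eq₃ k (combine (f₁ i) (f₂ j)) ⟩
        ψ (combine (f₁ i) (f₂ j)) ≡⟨ eq₂ j (f₁ i) ⟩
        φ (f₁ i)                 ≡⟨ eq₁ i zero ⟩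
        c zero                   ∎
    }
    where open ≡-Reasoning

-- Order-preserving maps between consecutive blocks

_⊕_ : ∀ {a b c d} → (Fin a → Fin b) → (Fin c → Fin d) → Fin (a + c) → Fin (b + d)
_⊕_ {a} {b} {c} {d} f g = join b d ∘ Sum.map f g ∘ splitAt a

⊕-monotone : ∀ {a b c d} {f : Fin a → Fin b} {g : Fin c → Fin d} →
             Monotone f → Monotone g → Monotone (f ⊕ g)
⊕-monotone {a} {b} {c} {d} {f} {g} mono-f mono-g {i} {j} i<j
  with splitAt a i in eqᵢ | splitAt a j in eqⱼ
... | inj₁ x | inj₁ y = subst₂ _<_ (sym (Fin.toℕ-↑ˡ (f x) d)) (sym (Fin.toℕ-↑ˡ (f y) d))
  (mono-f (subst₂ _<_ (trans (cong toℕ (sym (Fin.splitAt⁻¹-↑ˡ eqᵢ))) (Fin.toℕ-↑ˡ x c))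
                      (trans (cong toℕ (sym (Fin.splitAt⁻¹-↑ˡ eqⱼ))) (Fin.toℕ-↑ˡ y c)) i<j))
... | inj₁ x | inj₂ y = subst₂ _<_ (sym (Fin.toℕ-↑ˡ (f x) d)) (sym (Fin.toℕ-↑ʳ b (g y)))
  (<-≤-trans (Fin.toℕ<n (f x)) (m≤m+n b _))
... | inj₂ x | inj₁ y = contradiction i<j (<⇒≯ (subst₂ _<_
  (trans (sym (Fin.toℕ-↑ˡ y c)) (cong toℕ (Fin.splitAt⁻¹-↑ˡ eqⱼ)))
  (trans (sym (Fin.toℕ-↑ʳ a x)) (cong toℕ (Fin.splitAt⁻¹-↑ʳ eqᵢ)))
  (<-≤-trans (Fin.toℕ<n y) (m≤m+n a _))))
... | inj₂ x | inj₂ y = subst₂ _<_ (sym (Fin.toℕ-↑ʳ b (g x))) (sym (Fin.toℕ-↑ʳ b (g y)))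
  (+-monoʳ-< b (mono-g (+-cancelˡ-< a _ _ (subst₂ _<_
    (trans (cong toℕ (sym (Fin.splitAt⁻¹-↑ʳ eqᵢ))) (Fin.toℕ-↑ʳ a x))
    (trans (cong toℕ (sym (Fin.splitAt⁻¹-↑ʳ eqⱼ))) (Fin.toℕ-↑ʳ a y)) i<j))))

⊕-↑ˡ : ∀ {a b c d} (f : Fin a → Fin b) (g : Fin c → Fin d) i → (f ⊕ g) (i ↑ˡ c) ≡ f i ↑ˡ d
⊕-↑ˡ {a} {b} {c} {d} f g i = cong (join b d ∘ Sum.map f g) (Fin.splitAt-↑ˡ a i c)

⊕-↑ʳ : ∀ {a b c d} (f : Fin a → Fin b) (g : Fin c → Fin d) i → (f ⊕ g) (a ↑ʳ i) ≡ b ↑ʳ g i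
⊕-↑ʳ {a} {b} {c} {d} f g i = cong (join b d ∘ Sum.map f g) (Fin.splitAt-↑ʳ a c i)

-- The trailing 0 makes blockSize n n n definitionally the size 3 * n of K₃ n.
blockSize : ℕ → ℕ → ℕ → ℕ
blockSize a b c = a + (b + (c + 0))

module _ {a b c : ℕ} where

  ι₁ : Fin a → Fin (blockSize a b c)
  ι₁ i = i ↑ˡ (b + (c + 0))

  ι₂ : Fin b → Fin (blockSize a b c)
  ι₂ j = a ↑ʳ (j ↑ˡ (c + 0))

  ι₃ : Fin c → Fin (blockSize a b c)
  ι₃ k = a ↑ʳ (b ↑ʳ (k ↑ˡ 0))

  toℕ-ι₁ : ∀ i → toℕ (ι₁ i) ≡ toℕ i
  toℕ-ι₁ i = Fin.toℕ-↑ˡ i _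

  toℕ-ι₂ : ∀ j → toℕ (ι₂ j) ≡ a + toℕ j
  toℕ-ι₂ j = trans (Fin.toℕ-↑ʳ a _) (cong (a +_) (Fin.toℕ-↑ˡ j _))

  toℕ-ι₃ : ∀ k → toℕ (ι₃ k) ≡ a + (b + toℕ k)
  toℕ-ι₃ k = trans (Fin.toℕ-↑ʳ a _)
    (cong (a +_) (trans (Fin.toℕ-↑ʳ b _) (cong (b +_) (Fin.toℕ-↑ˡ k 0))))

  triple : Fin a → Fin b → Fin c → Vec (Fin (blockSize a b c)) 3
  triple i j k = ι₁ i ∷ ι₂ j ∷ ι₃ k ∷ []

  triple-increasing : ∀ i j k → Increasing (triple i j k)
  triple-increasing i j k =
    subst₂ _<_ (sym (toℕ-ι₁ i)) (sym (toℕ-ι₂ j)) (<-≤-trans (Fin.toℕ<n i) (m≤m+n a _)) ∷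
    subst₂ _<_ (sym (toℕ-ι₂ j)) (sym (toℕ-ι₃ k))
      (+-monoʳ-< a (<-≤-trans (Fin.toℕ<n j) (m≤m+n b _))) ∷
    [-]

  ι₁-monotone : Monotone ι₁
  ι₁-monotone = subst₂ _<_ (sym (toℕ-ι₁ _)) (sym (toℕ-ι₁ _))

  ι₂-monotone : Monotone ι₂
  ι₂-monotone = subst₂ _<_ (sym (toℕ-ι₂ _)) (sym (toℕ-ι₂ _)) ∘ +-monoʳ-< a

  ι₃-monotone : Monotone ι₃
  ι₃-monotone =
    subst₂ _<_ (sym (toℕ-ι₃ _)) (sym (toℕ-ι₃ _)) ∘ +-monoʳ-< a ∘ +-monoʳ-< b

module _ {T a b c : ℕ} (a≤T : a ≤ T) (b≤T : b ≤ T) (c≤T : c ≤ T)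
         (χ : Colouring 3 (blockSize (P₁ T) (P₂ T) (P₃ T)))
         (hom : Homogeneous T (λ i j k → χ (triple i j k))) where
  open Homogeneous hom

  private
    g₁ = f₁ ∘ (λ i → inject≤ i a≤T)
    g₂ = f₂ ∘ (λ i → inject≤ i b≤T)
    g₃ = f₃ ∘ (λ i → inject≤ i c≤T)

    φ₀ : Fin 0 → Fin 0
    φ₀ ()

    φ : Fin (blockSize a b c) → Fin (blockSize (P₁ T) (P₂ T) (P₃ T))
    φ = g₁ ⊕ (g₂ ⊕ (g₃ ⊕ φ₀))

    φ-monotone : Monotone φ
    φ-monotone = ⊕-monotone (mono₁ ∘ inject≤-monotone a≤T)
      (⊕-monotone (mono₂ ∘ inject≤-monotone b≤T)
      (⊕-monotone {f = g₃} {g = φ₀} (mono₃ ∘ inject≤-monotone c≤T) (λ { {()} })))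

    φ-triple : ∀ i j k → Vec.map φ (triple i j k) ≡ triple (g₁ i) (g₂ j) (g₃ k)
    φ-triple i j k = cong₂ _∷_ (⊕-↑ˡ g₁ _ i)
      (cong₂ _∷_ (trans (⊕-↑ʳ g₁ _ _) (cong (P₁ T ↑ʳ_) (⊕-↑ˡ g₂ _ j)))
      (cong (_∷ []) (trans (⊕-↑ʳ g₁ _ _) (cong (P₁ T ↑ʳ_)
        (trans (⊕-↑ʳ g₂ (g₃ ⊕ φ₀) _) (cong (P₂ T ↑ʳ_) (⊕-↑ˡ g₃ φ₀ k)))))))

  -- Both `apexGraph m` and `K₃ n` have only edges of the form `triple i j k`, so this one embedding
  -- of a complete tripartite block serves whichever colour comes out.
  homogeneous⇒embedding : ∃ λ (φ : Fin (blockSize a b c) → Fin (blockSize (P₁ T) (P₂ T) (P₃ T))) →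
    Monotone φ × (∀ i j k → Edge (colourClass χ colour) (Vec.map φ (triple {a} {b} {c} i j k)))
  homogeneous⇒embedding = φ , φ-monotone , edge
    where
    edge : ∀ i j k → Edge (colourClass χ colour) (Vec.map φ (triple i j k))
    edge i j k rewrite φ-triple i j k = triple-increasing _ _ _ , constant _ _ _

-- Edges of `K₃ n` in block coordinates

module _ {n : ℕ} where

  transversal⁺ : ∀ i j k → Edge (K₃ n) (triple {n} {n} {n} i j k)
  transversal⁺ i j k =
    (z≤n , subst₂ _<_ (sym (toℕ-ι₁ {n} {n} {n} i)) (sym (+-identityʳ n)) (Fin.toℕ<n i)) ,
    (subst₂ _≤_ (sym (+-identityʳ n)) (sym (toℕ-ι₂ {n} {n} {n} j)) (m≤m+n n _) ,
     subst₂ _<_ (sym (toℕ-ι₂ {n} {n} {n} j)) (cong (n +_) (sym (+-identityʳ n))) (+-monoʳ-< n (Fin.toℕ<n j))) ,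
    (subst₂ _≤_ (cong (n +_) (sym (+-identityʳ n))) (sym (toℕ-ι₃ {n} {n} {n} k)) (+-monoʳ-≤ n (m≤m+n n _)) ,
     subst₂ _<_ (sym (toℕ-ι₃ {n} {n} {n} k)) (cong (λ t → n + (n + t)) (sym (+-identityʳ n)))
       (+-monoʳ-< n (+-monoʳ-< n (Fin.toℕ<n k))))

  inClass⇒offset : ∀ l {v : Fin (3 * n)} → InClass {n} l v → ∃ λ (i : Fin n) → toℕ v ≡ l * n + toℕ i
  inClass⇒offset l {v} (l*n≤v , v<) = fromℕ< {toℕ v ∸ l * n} below ,
    trans (sym (m+[n∸m]≡n l*n≤v)) (cong (l * n +_) (sym (Fin.toℕ-fromℕ< below)))
    where
    below : toℕ v ∸ l * n < n
    below = +-cancelˡ-< (l * n) _ n (subst₂ _<_ (sym (m+[n∸m]≡n l*n≤v))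
      (trans (*-distribʳ-+ n l 1) (cong (l * n +_) (*-identityˡ n))) v<)

  transversal⁻ : ∀ {e} → Edge (K₃ n) e → ∃ λ i → ∃ λ j → ∃ λ k → e ≡ triple {n} {n} {n} i j k
  transversal⁻ {x ∷ y ∷ z ∷ []} (x∈ , y∈ , z∈)
    with i , eqx ← inClass⇒offset 0 {x} x∈
    with j , eqy ← inClass⇒offset 1 {y} y∈
    with k , eqz ← inClass⇒offset 2 {z} z∈ =
    i , j , k , cong₂ _∷_ (Fin.toℕ-injective (trans eqx (sym (toℕ-ι₁ {n} {n} {n} i))))
      (cong₂ _∷_ (Fin.toℕ-injective (trans eqy
        (trans (cong (_+ toℕ j) (+-identityʳ n)) (sym (toℕ-ι₂ {n} {n} {n} j)))))
      (cong (_∷ []) (Fin.toℕ-injective (trans eqz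
        (trans (trans (+-assoc n (n + 0) (toℕ k)) (cong (λ t → n + (t + toℕ k)) (+-identityʳ n)))
          (sym (toℕ-ι₃ {n} {n} {n} k)))))))

-- The apex graph: degeneracy and a finite Ramsey bound

module _ (m : ℕ) where

  apexEdge : Fin m → Fin m → Vec (Fin (blockSize m m (m * m))) 3
  apexEdge i j = triple i j (combine i j)

  apexGraph : OrderedGraph 3
  apexGraph = record
    { size       = blockSize m m (m * m)
    ; Edge       = λ e → ∃ λ i → ∃ λ j → e ≡ apexEdge i j
    ; edge?      = λ e → Fin.any? λ i → Fin.any? λ j → Vec.≡-dec Fin._≟_ e (apexEdge i j)
    ; increasing = λ { (i , j , refl) → triple-increasing i j (combine i j) }
    }

  -- In the left-to-right order an edge is charged to its rightmost vertex: from either other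
  -- vertex, the apex `w` would have to come earlier.
  backEdge⇒apex : ∀ {x y z w : Fin (size apexGraph)} →
    BackEdge apexGraph Perm.id x (y ∷ z ∷ w ∷ []) → x ≡ w
  backEdge⇒apex (_ , there (there (here x≡w)) , _) = x≡w
  backEdge⇒apex {x} {y} {z} {w} (e∈ , here refl , back)
    with y<z ∷ z<w ∷ [-] ← increasing apexGraph e∈
    with j , j<x , refl ← back (there (there (here refl))) (Fin.<⇒≢ (Fin.<-trans y<z z<w) ∘ sym) =
    contradiction j<x (<⇒≯ (Fin.<-trans y<z z<w))
  backEdge⇒apex {x} {y} {z} {w} (e∈ , there (here refl) , back)
    with y<z ∷ z<w ∷ [-] ← increasing apexGraph e∈
    with j , j<x , refl ← back (there (there (here refl))) (Fin.<⇒≢ z<w ∘ sym) =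
    contradiction j<x (<⇒≯ z<w)

  -- The apex determines its pair, because `combine` and `ι₃` are injective.
  backEdge-unique : ∀ {x e e′} → BackEdge apexGraph Perm.id x e →
                    BackEdge apexGraph Perm.id x e′ → e ≡ e′
  backEdge-unique b@((i , j , refl) , _) b′@((i′ , j′ , refl) , _)
    with refl , refl ← Fin.combine-injective i j i′ j′
           (monotone⇒injective (ι₃-monotone {m} {m})
             (trans (sym (backEdge⇒apex b)) (backEdge⇒apex b′))) = refl

  apexGraph-degenerate : Degenerate 1 apexGraph
  apexGraph-degenerate = Perm.id , λ where
    x []            _                  _            → z≤n
    x (_ ∷ [])      _                  _            → ≤-refl
    x (_ ∷ _ ∷ _) ((e≢e′ ∷ _) ∷ _) (b ∷ b′ ∷ _) → contradiction (backEdge-unique b b′) e≢e′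

module _ (m n : ℕ) where

  private
    -- A sum rather than a maximum: any common bound for the class sizes m, m * m and n will do.
    T = m + (m * m + n)
    N = blockSize (P₁ T) (P₂ T) (P₃ T)

    m≤T : m ≤ T
    m≤T = m≤m+n m _

    m*m≤T : m * m ≤ T
    m*m≤T = ≤-trans (m≤m+n (m * m) n) (m≤n+m _ m)

    n≤T : n ≤ T
    n≤T = ≤-trans (m≤n+m n (m * m)) (m≤n+m _ m)

  -- Guarantees that the Ramsey number exists, giving the search for the least value a starting
  -- point.
  apexGraph-arrows : Arrows N (apexGraph m) (K₃ n)
  apexGraph-arrows χ with homogeneous T (λ i j k → χ (triple i j k))
  ... | hom with Homogeneous.colour hom in eq
  ... | blue with φ , mono , edge ← homogeneous⇒embedding m≤T m≤T m*m≤T χ hom =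
    inj₁ (φ , mono , λ { (i , j , refl) → map₂ (λ col → trans col eq) (edge i j (combine i j)) })
  ... | red with φ , mono , edge ← homogeneous⇒embedding n≤T n≤T n≤T χ hom =
    inj₂ (φ , mono , red-edge)
    where
    red-edge : ∀ {e} → Edge (K₃ n) e → Edge (colourClass χ red) (Vec.map φ e)
    red-edge e∈ with i , j , k , refl ← transversal⁻ e∈ =
      map₂ (λ col → trans col eq) (edge i j k)

-- Least Ramsey numbers

-- Functions are enumerated through their codes. Decoding restores a function only up to `≗`, so `P`
-- is asked to respect pointwise equality.
decide-∃ : ∀ {a b} {P : Pred (Fin a → Fin b) 0ℓ} →
           (∀ {f g} → f ≗ g → P f → P g) → Decidable P → Dec (∃ P)
decide-∃ resp P? = map′
  (λ (k , p) → finToFun k , p)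
  (λ (f , p) → funToFin f , resp (λ i → sym (Fin.finToFun-funToFin f i)) p)
  (Fin.any? (P? ∘ finToFun))

decide-∀ : ∀ {a b} {P : Pred (Fin a → Fin b) 0ℓ} →
           (∀ {f g} → f ≗ g → P f → P g) → Decidable P → Dec (∀ f → P f)
decide-∀ resp P? = map′
  (λ all f → resp (Fin.finToFun-funToFin f) (all (funToFin f)))
  (λ all k → all (finToFun k))
  (Fin.all? (P? ∘ finToFun))

monotone? : ∀ {a b} → Decidable (Monotone {a} {b})
monotone? f = map′ (λ mono {i} {j} → mono i j) (λ mono i j → mono)
  (Fin.all? λ i → Fin.all? λ j → (i Fin.<? j) →-dec (f i Fin.<? f j))

∀triples? : ∀ {s} {P : Pred (Vec (Fin s) 3) 0ℓ} → Decidable P → Dec (∀ {e} → P e)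
∀triples? P? = map′ (λ { all {x ∷ y ∷ z ∷ []} → all x y z }) (λ all x y z → all)
  (Fin.all? λ x → Fin.all? λ y → Fin.all? λ z → P? (x ∷ y ∷ z ∷ []))

contains? : (G H : OrderedGraph 3) → Dec (Contains G H)
contains? G H = decide-∃ transport λ φ →
  monotone? φ ×-dec ∀triples? (λ e → edge? H e →-dec edge? G (Vec.map φ e))
  where
  transport : ∀ {φ ψ : Fin (size H) → Fin (size G)} → φ ≗ ψ →
         Monotone φ × (∀ {e} → Edge H e → Edge G (Vec.map φ e)) →
         Monotone ψ × (∀ {e} → Edge H e → Edge G (Vec.map ψ e))
  transport φ≗ψ (mono , edge) =
    (λ {i} {j} i<j → subst₂ Fin._<_ (φ≗ψ i) (φ≗ψ j) (mono i<j)) ,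
    (λ {e} e∈ → subst (Edge G) (Vec.map-cong φ≗ψ e) (edge e∈))

Contains-recolour : ∀ {N} {χ χ′ : Colouring 3 N} {c} {H : OrderedGraph 3} → χ ≗ χ′ →
                    Contains (colourClass χ c) H → Contains (colourClass χ′ c) H
Contains-recolour χ≗χ′ (φ , mono , edge) =
  φ , mono , λ e∈ → map₂ (trans (sym (χ≗χ′ _))) (edge e∈)

tripleIndex : ∀ {N} → Vec (Fin N) 3 → Fin (N * N * N)
tripleIndex (x ∷ y ∷ z ∷ []) = combine (combine x y) z

indexTriple : ∀ {N} → Fin (N * N * N) → Vec (Fin N) 3
indexTriple {N} t =
  let xy , z = Fin.remQuot {N * N} N t
      x , y  = Fin.remQuot {N} N xy
  in x ∷ y ∷ z ∷ []

indexTriple-tripleIndex : ∀ {N} (e : Vec (Fin N) 3) → indexTriple (tripleIndex e) ≡ e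
indexTriple-tripleIndex {N} (x ∷ y ∷ z ∷ []) = trans
  (cong (λ (xy , z) → let x , y = Fin.remQuot {N} N xy in x ∷ y ∷ z ∷ [])
        (Fin.remQuot-combine (combine x y) z))
  (cong (λ (x , y) → x ∷ y ∷ z ∷ []) (Fin.remQuot-combine x y))

arrows? : ∀ N (G H : OrderedGraph 3) → Dec (Arrows N G H)
arrows? N G H = map′
  (λ all χ → Monochromatic-resp (recode χ) (all (encode ∘ χ ∘ indexTriple)))
  (λ arrows f → arrows (colouring f))
  (decide-∀ {P = Monochromatic ∘ colouring}
    (λ f≗g → Monochromatic-resp (λ e → cong decode (f≗g (tripleIndex e))))
    (λ f → contains? (colourClass (colouring f) blue) G ⊎-dec contains? (colourClass (colouring f) red) H))
  where
  Monochromatic : Colouring 3 N → Set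
  Monochromatic χ = Contains (colourClass χ blue) G ⊎ Contains (colourClass χ red) H

  Monochromatic-resp : ∀ {χ χ′} → χ ≗ χ′ → Monochromatic χ → Monochromatic χ′
  Monochromatic-resp χ≗χ′ = Sum.map (Contains-recolour {H = G} χ≗χ′) (Contains-recolour {H = H} χ≗χ′)

  colouring : (Fin (N * N * N) → Fin 2) → Colouring 3 N
  colouring f e = decode (f (tripleIndex e))

  recode : ∀ χ → colouring (encode ∘ χ ∘ indexTriple) ≗ χ
  recode χ e = trans (decode-encode _) (cong χ (indexTriple-tripleIndex e))

map-increasing : ∀ {a b} {f : Fin a → Fin b} → Monotone f →
                 ∀ {k} {e : Vec (Fin a) k} → Increasing e → Increasing (Vec.map f e)
map-increasing mono inc = Linked.map⁺ (Linked.map mono inc)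

-- Restrict the colouring to the first M vertices. This is what turns a failure at N into a strict
-- lower bound on the least value.
arrows-mono : ∀ {k M N} {G H : OrderedGraph k} → M ≤ N → Arrows M G H → Arrows N G H
arrows-mono {k} {M} {N} {G} {H} M≤N arrows χ =
  Sum.map (transfer {G}) (transfer {H}) (arrows (χ ∘ Vec.map inj))
  where
  inj : Fin M → Fin N
  inj i = inject≤ i M≤N

  transfer : ∀ {K c} → Contains (colourClass (χ ∘ Vec.map inj) c) K → Contains (colourClass χ c) K
  transfer {K} {c} (φ , mono , edge) = inj ∘ φ , inject≤-monotone M≤N ∘ mono , edge′
    where
    edge′ : ∀ {e} → Edge K e → Edge (colourClass χ c) (Vec.map (inj ∘ φ) e)
    edge′ {e} e∈ with inc , col ← edge e∈ =
      subst (Edge (colourClass χ c)) (sym (Vec.map-∘ inj φ e))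
        (map-increasing (inject≤-monotone M≤N) inc , col)

least : ∀ {P : Pred ℕ 0ℓ} → Decidable P → ∀ n → P n → ∃ λ r → P r × (∀ m → P m → r ≤ m)
least P? zero    p = zero , p , λ _ _ → z≤n
least P? (suc n) p with P? zero
... | yes p₀ = zero , p₀ , λ _ _ → z≤n
... | no ¬p₀ with r , pr , min ← least (P? ∘ suc) n p =
  suc r , pr , λ { zero p₀ → contradiction p₀ ¬p₀ ; (suc m) pm → s≤s (min m pm) }

ramsey-number-above : ∀ {N M} {G H : OrderedGraph 3} → Arrows M G H → ¬ Arrows N G H →
                      ∃ λ r → IsOrderedRamseyNumber G H r × N < r
ramsey-number-above {N} {M} {G} {H} arrows ¬arrows
  with r , arrows-r , min ← least (λ K → arrows? K G H) M arrows =
  r , (arrows-r , min) , ≰⇒> λ r≤N → ¬arrows (arrows-mono {G = G} {H} r≤N arrows-r)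

apexGraph-avoidable : ∀ {N} m n .{{_ : NonZero n}} (χ : Fin N → Fin N → Colour) →
  NoMonochromatic χ red n → NoMonochromatic χ blue m → ¬ Arrows N (apexGraph m) (K₃ n)
apexGraph-avoidable m n@(suc _) χ no-red no-blue arrows
  with arrows (λ { (x ∷ y ∷ _ ∷ []) → χ x y })
... | inj₁ (φ , mono , edge) = no-blue (φ ∘ ι₁ {m} {m} {m * m}) (φ ∘ ι₂ {m} {m} {m * m})
  (monotone⇒injective (mono ∘ ι₁-monotone {m} {m} {m * m}))
  (monotone⇒injective (mono ∘ ι₂-monotone {m} {m} {m * m}))
  (λ i j → proj₂ (edge (i , j , refl)))
... | inj₂ (φ , mono , edge) = no-red (φ ∘ ι₁ {n} {n} {n}) (φ ∘ ι₂ {n} {n} {n})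
  (monotone⇒injective (mono ∘ ι₁-monotone {n} {n} {n}))
  (monotone⇒injective (mono ∘ ι₂-monotone {n} {n} {n}))
  -- The third class must be inhabited for a pair to extend to an edge; `zero` exists as n is a
  -- successor.
  (λ i j → proj₂ (edge (transversal⁺ i j zero)))

-- Numerical estimates

-- For p > 0 this is Bernoulli's inequality 1 + k/p ≤ (1 + 1/p)^k with denominators cleared.
bernoulli : ∀ p k → p ^ k * (p + k) ≤ p * suc p ^ k
bernoulli p zero = ≤-reflexive (solve 1 (λ p → con 1 :* (p :+ con 0) := p :* con 1) refl p)
  where open +-*-Solver
bernoulli p (suc k) = begin
  p * p ^ k * (p + suc k)             ≤⟨ m≤m+n _ (p ^ k * k) ⟩
  p * p ^ k * (p + suc k) + p ^ k * k ≡⟨ solve 3 (λ p k x → p :* x :* (p :+ (con 1 :+ k)) :+ x :* k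
                                           := (con 1 :+ p) :* (x :* (p :+ k))) refl p k (p ^ k) ⟩
  suc p * (p ^ k * (p + k))           ≤⟨ *-monoʳ-≤ (suc p) (bernoulli p k) ⟩
  suc p * (p * suc p ^ k)             ≡⟨ solve 3 (λ s p y → s :* (p :* y) := p :* (s :* y)) refl (suc p) p (suc p ^ k) ⟩
  p * (suc p * suc p ^ k)             ∎
  where
  open ≤-Reasoning
  open +-*-Solver

-- That is, (1 - 1/q)^q ≤ 1/2 for q = p + 1: Bernoulli at k = q gives (1 + 1/p)^q ≥ 1 + q/p ≥ 2.
2*p^q≤q^q : ∀ p → 2 * p ^ suc p ≤ suc p ^ suc p
2*p^q≤q^q zero = z≤n
2*p^q≤q^q p@(suc _) = *-cancelˡ-≤ p (begin
  p * (2 * p ^ suc p)      ≡⟨ solve 2 (λ p x → p :* (con 2 :* x) := x :* (p :+ p)) refl p (p ^ suc p) ⟩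
  p ^ suc p * (p + p)      ≤⟨ *-monoʳ-≤ (p ^ suc p) (+-monoʳ-≤ p (n≤1+n p)) ⟩
  p ^ suc p * (p + suc p)  ≤⟨ bernoulli p (suc p) ⟩
  p * suc p ^ suc p        ∎)
  where
  open ≤-Reasoning
  open +-*-Solver

^-distribʳ-* : ∀ m n o → (m * n) ^ o ≡ m ^ o * n ^ o
^-distribʳ-* m n zero = refl
^-distribʳ-* m n (suc o) rewrite ^-distribʳ-* m n o =
  solve 4 (λ m n x y → m :* n :* (x :* y) := m :* x :* (n :* y)) refl m n (m ^ o) (n ^ o)
  where open +-*-Solver

2^k*p^qk≤q^qk : ∀ p k → 2 ^ k * p ^ (suc p * k) ≤ suc p ^ (suc p * k)
2^k*p^qk≤q^qk p k = begin
  2 ^ k * p ^ (suc p * k)   ≡⟨ cong (2 ^ k *_) (^-*-assoc p (suc p) k) ⟨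
  2 ^ k * (p ^ suc p) ^ k   ≡⟨ ^-distribʳ-* 2 (p ^ suc p) k ⟨
  (2 * p ^ suc p) ^ k       ≤⟨ ^-monoˡ-≤ k (2*p^q≤q^q p) ⟩
  (suc p ^ suc p) ^ k       ≡⟨ ^-*-assoc (suc p) (suc p) k ⟩
  suc p ^ (suc p * k)       ∎
  where open ≤-Reasoning

n<2^n : ∀ n → n < 2 ^ n
n<2^n zero = ≤-refl
n<2^n (suc n) = begin
  2 + n           ≤⟨ s≤s (m≤n+m (suc n) n) ⟩
  suc n + suc n   ≤⟨ +-mono-≤ (n<2^n n) (n<2^n n) ⟩
  2 ^ n + 2 ^ n   ≡⟨ cong (2 ^ n +_) (+-identityʳ (2 ^ n)) ⟨
  2 ^ suc n       ∎
  where open ≤-Reasoning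

-- Goes through (n + 1)³, which exceeds 2n² by 1 + 3n + n² + n³ and is at most (2ⁿ)³.
2n²<8^n : ∀ n → 2 * n ^ 2 < 2 ^ (3 * n)
2n²<8^n n = begin-strict
  2 * n ^ 2      <⟨ m<m+n _ z<s ⟩
  2 * n ^ 2 + suc (3 * n + n * n + n * n * n)
                 ≡⟨ solve 1 (λ n → con 2 :* (n :* (n :* con 1)) :+ (con 1 :+ (con 3 :* n :+ n :* n :+ n :* n :* n))
                      := (con 1 :+ n) :* ((con 1 :+ n) :* ((con 1 :+ n) :* con 1))) refl n ⟩
  suc n ^ 3      ≤⟨ ^-monoˡ-≤ 3 (n<2^n n) ⟩
  (2 ^ n) ^ 3    ≡⟨ ^-*-assoc 2 n 3 ⟩
  2 ^ (n * 3)    ≡⟨ cong (2 ^_) (*-comm n 3) ⟩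
  2 ^ (3 * n)    ∎
  where
  open ≤-Reasoning
  open +-*-Solver

2N^k² : ∀ s k → 2 * ((2 ^ s) ^ k * (2 ^ s) ^ k) ≡ 2 ^ suc (2 * s * k)
2N^k² s k = cong (2 *_) (begin
  (2 ^ s) ^ k * (2 ^ s) ^ k  ≡⟨ cong₂ _*_ (^-*-assoc 2 s k) (^-*-assoc 2 s k) ⟩
  2 ^ (s * k) * 2 ^ (s * k)  ≡⟨ ^-distribˡ-+-* 2 (s * k) (s * k) ⟨
  2 ^ (s * k + s * k)        ≡⟨ cong (2 ^_) (solve 2 (λ s k → s :* k :+ s :* k := con 2 :* s :* k) refl s k) ⟩
  2 ^ (2 * s * k)            ∎)
  where
  open ≡-Reasoning
  open +-*-Solver

-- In exponents of 2 this is 1 + 2n³ < 3n³, the source of the threshold n ≥ 2.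
few-red : ∀ n q → 2 ≤ n → q ≡ 2 ^ (3 * n) →
          2 * ((2 ^ n ^ 2) ^ n * (2 ^ n ^ 2) ^ n) < q ^ (n * n)
few-red n q 2≤n refl = begin-strict
  2 * ((2 ^ n ^ 2) ^ n * (2 ^ n ^ 2) ^ n)  ≡⟨ 2N^k² (n ^ 2) n ⟩
  2 ^ suc (2 * n ^ 2 * n)                  <⟨ ^-monoʳ-< 2 ≤-refl exponents ⟩
  2 ^ (3 * n * (n * n))                    ≡⟨ ^-*-assoc 2 (3 * n) (n * n) ⟨
  (2 ^ (3 * n)) ^ (n * n)                  ∎
  where
  open ≤-Reasoning
  open +-*-Solver
  exponents : suc (2 * n ^ 2 * n) < 3 * n * (n * n)
  exponents = begin-strict
    1 + 2 * n ^ 2 * n              <⟨ +-monoˡ-< (2 * n ^ 2 * n) {1} {n * (n * n)}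
                                        (≤-trans (s≤s (s≤s z≤n)) (*-mono-≤ 2≤n (*-mono-≤ 2≤n 2≤n))) ⟩
    n * (n * n) + 2 * n ^ 2 * n    ≡⟨ solve 1 (λ n → n :* (n :* n) :+ con 2 :* (n :* (n :* con 1)) :* n
                                        := con 3 :* n :* (n :* n)) refl n ⟩
    3 * n * (n * n)                ∎

-- Since m = q², the m² cells form q m groups of q cells, each group at least halving the
-- probability; what remains is 1 + 2n²m ≤ q m.
few-blue : ∀ n p → suc p ≡ 2 ^ (3 * n) → let m = suc p * suc p in
  2 * ((2 ^ n ^ 2) ^ m * (2 ^ n ^ 2) ^ m) * p ^ (m * m) ≤ suc p ^ (m * m)
few-blue n p q≡8^n = begin
  2 * ((2 ^ n ^ 2) ^ m * (2 ^ n ^ 2) ^ m) * p ^ (m * m)  ≡⟨ cong (_* p ^ (m * m)) (2N^k² (n ^ 2) m) ⟩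
  2 ^ suc (2 * n ^ 2 * m) * p ^ (m * m)                  ≤⟨ *-monoˡ-≤ (p ^ (m * m)) (^-monoʳ-≤ 2 exponents) ⟩
  2 ^ (suc p * m) * p ^ (m * m)                          ≡⟨ cong (λ t → 2 ^ (suc p * m) * p ^ t) (*-assoc (suc p) (suc p) m) ⟩
  2 ^ (suc p * m) * p ^ (suc p * (suc p * m))            ≤⟨ 2^k*p^qk≤q^qk p (suc p * m) ⟩
  suc p ^ (suc p * (suc p * m))                          ≡⟨ cong (suc p ^_) (*-assoc (suc p) (suc p) m) ⟨
  suc p ^ (m * m)                                        ∎
  where
  open ≤-Reasoning
  m = suc p * suc p
  exponents : suc (2 * n ^ 2 * m) ≤ suc p * m
  exponents = begin
    1 + 2 * n ^ 2 * m      ≤⟨ +-monoˡ-≤ (2 * n ^ 2 * m) (s≤s z≤n) ⟩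
    suc (2 * n ^ 2) * m    ≤⟨ *-monoˡ-≤ m (2n²<8^n n) ⟩
    2 ^ (3 * n) * m        ≡⟨ cong (_* m) q≡8^n ⟨
    suc p * m              ∎

-- Origin of 13: m² = q⁴ = 2^(12n), and the two small classes at most double this, a factor absorbed
-- into 2ⁿ.
apexGraph-size : ∀ n .{{_ : NonZero n}} q → q ≡ 2 ^ (3 * n) → size (apexGraph (q * q)) ≤ 2 ^ (13 * n)
apexGraph-size n q refl = begin
  m + (m + (m * m + 0))   ≡⟨ solve 1 (λ m → m :+ (m :+ (m :* m :+ con 0)) := con 2 :* m :+ m :* m) refl m ⟩
  2 * m + m * m           ≤⟨ +-monoˡ-≤ (m * m) (*-monoˡ-≤ m 2≤m) ⟩
  m * m + m * m           ≡⟨ cong (m * m +_) (+-identityʳ (m * m)) ⟨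
  2 * (m * m)             ≤⟨ *-monoˡ-≤ (m * m) (^-monoʳ-≤ 2 (>-nonZero⁻¹ n)) ⟩
  2 ^ n * (m * m)         ≡⟨ cong (2 ^ n *_) m*m≡ ⟩
  2 ^ n * 2 ^ (12 * n)    ≡⟨ ^-distribˡ-+-* 2 n (12 * n) ⟨
  2 ^ (13 * n)            ∎
  where
  open ≤-Reasoning
  open +-*-Solver
  m = q * q
  m≡ : m ≡ 2 ^ (6 * n)
  m≡ = trans (sym (^-distribˡ-+-* 2 (3 * n) (3 * n)))
             (cong (2 ^_) (solve 1 (λ n → con 3 :* n :+ con 3 :* n := con 6 :* n) refl n))
  m*m≡ : m * m ≡ 2 ^ (12 * n)
  m*m≡ = trans (cong₂ _*_ m≡ m≡) (trans (sym (^-distribˡ-+-* 2 (6 * n) (6 * n)))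
    (cong (2 ^_) (solve 1 (λ n → con 6 :* n :+ con 6 :* n := con 12 :* n) refl n)))
  2≤m : 2 ≤ m
  2≤m = subst (2 ≤_) (sym m≡) (^-monoʳ-≤ 2 (≤-trans (>-nonZero⁻¹ n) (m≤n*m n 6)))

theorem1p7 : Σ ℚ λ c → Σ ℚ λ C → Positive c × Positive C ×
    (Σ ℕ λ n₀ → ∀ (n : ℕ) → n₀ ≤ n →
    Σ (OrderedGraph 3) λ F →
    Degenerate 1 F ×
    (size F ≤2^[ C · n ]) ×
    (Σ ℕ λ r → IsOrderedRamseyNumber F (K₃ n) r × (2^[ c · n ^ 2 ]< r)))
theorem1p7 = 1ℚ , ℤ.+ 13 / 1 , _ , _ , 2 , witness
  where
  witness : ∀ n → 2 ≤ n → Σ (OrderedGraph 3) λ F →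
    Degenerate 1 F × (size F ≤2^[ ℤ.+ 13 / 1 · n ]) ×
    (Σ ℕ λ r → IsOrderedRamseyNumber F (K₃ n) r × (2^[ 1ℚ · n ^ 2 ]< r))
  witness n@(suc _) 2≤n =
    let χ , no-red , no-blue = random-colouring p n m (2 ^ n ^ 2)
          (few-red n (suc p) 2≤n q≡8^n) (few-blue n p q≡8^n)
        r , isRamsey , N<r = ramsey-number-above {G = apexGraph m} {K₃ n}
          (apexGraph-arrows m n) (apexGraph-avoidable m n χ no-red no-blue)
    in apexGraph m , apexGraph-degenerate m ,
       subst (_≤ 2 ^ (13 * n)) (sym (*-identityʳ _)) (apexGraph-size n (suc p) q≡8^n) ,
       r , isRamsey ,
       subst₂ _<_ (cong (2 ^_) (sym (*-identityˡ (n ^ 2)))) (sym (*-identityʳ r)) N<r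
    where
    -- The blue weight is one less than 8ⁿ, so that red has probability 1 / `suc p` = 8⁻ⁿ exactly.
    p = pred (2 ^ (3 * n))
    q≡8^n : suc p ≡ 2 ^ (3 * n)
    q≡8^n = suc-pred (2 ^ (3 * n)) {{m^n≢0 2 (3 * n)}}
    m = suc p * suc p
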